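{- Consider the following nondeterministic program on states $(x,y,z)\in\mathbb{Z}^3$. Initially $(x,y,z)$ is an arbitrary element of $\mathbb{Z}^3$ supplied by the user. While $x>0$ and $y>0$ and $z>0$, the user chooses a value $\mathrm{control}\in\{1,2,3\}$ and the following (simultaneous) assignment is executed: \begin{itemize} \item if $\mathrm{control}=1$: $(x,y,z)=(x+1,\,y-1,\,z-1)$; \item if $\mathrm{control}=2$: $(x,y,z)=(x-1,\,y+1,\,z-1)$; \item if $\mathrm{control}=3$: $(x,y,z)=(x-1,\,y-1,\,z+1)$. \end{itemize} Then every computation of this program is finite.
   Context: A program is a tuple $(S,I,R)$ where $S$ is a set of states, $I\subseteq S$ is the set of possible initial states, and $R\subseteq S\times S$ is the set of pairs $(s,t)$ such that $s$ satisfies the condition of the while loop and some choice of instruction (and of user inputs) takes $s$ to $t$ in one iteration of the loop body. A computation is a finite or infinite sequence of states $s_1,s_2,\ldots$ with $s_1\in I$, with $R(s_i,s_{i+1})$ for all consecutive terms, and such that if the sequence is finite with last state $s$ then there is no $t$ with $R(s,t)$. Here $S=I=\mathbb{Z}^3$. -}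

module Defs where

open import Level using (0ℓ)
open import Data.Integer using (ℤ; 0ℤ; 1ℤ; _+_; _-_; _>_)
open import Data.Maybe using (Maybe; just; nothing)
open import Data.Nat using (ℕ; suc)
open import Data.Product using (_×_; _,_; ∃-syntax)
open import Relation.Binary using (Rel)
open import Relation.Binary.PropositionalEquality using (_≡_)
open import Relation.Nullary using (¬_)
open import Relation.Unary using (Pred; U)

record Program : Set₁ where
  field
    State   : Set
    Initial : Pred State 0ℓ
    Step    : Rel State 0ℓ

-- A finite or infinite sequence, as a partial function whose domain is an
-- initial segment of ℕ.  Terms are numbered from 0: the term s₁ is at 0.
record Sequence (A : Set) : Set where
  field
    at     : ℕ → Maybe A
    closed : ∀ i → at i ≡ nothing → at (suc i) ≡ nothing

-- By closed, one undefined index bounds the domain.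
IsFinite : {A : Set} → Sequence A → Set
IsFinite s = ∃[ n ] Sequence.at s n ≡ nothing

record IsComputation (P : Program) (c : Sequence (Program.State P)) : Set where
  open Program P
  open Sequence c
  field
    starts  : ∃[ s ] at 0 ≡ just s × Initial s
    steps   : ∀ i {s t} → at i ≡ just s → at (suc i) ≡ just t → Step s t
    maximal : ∀ i {s} → at i ≡ just s → at (suc i) ≡ nothing → ¬ (∃[ t ] Step s t)

ℤ³ : Set
ℤ³ = ℤ × ℤ × ℤ

data Control : Set where
  control₁ control₂ control₃ : Control

LoopCondition : Pred ℤ³ 0ℓ
LoopCondition (x , y , z) = x > 0ℤ × y > 0ℤ × z > 0ℤ

loopBody : Control → ℤ³ → ℤ³
loopBody control₁ (x , y , z) = (x + 1ℤ , y - 1ℤ , z - 1ℤ)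
loopBody control₂ (x , y , z) = (x - 1ℤ , y + 1ℤ , z - 1ℤ)
loopBody control₃ (x , y , z) = (x - 1ℤ , y - 1ℤ , z + 1ℤ)

program : Program
program = record
  { State   = ℤ³
  ; Initial = U
  ; Step    = λ s t → LoopCondition s × ∃[ control ] t ≡ loopBody control s
  }

{-# OPTIONS --safe #-}
-- Every iteration of the loop lowers x + y + z by one, and the loop condition
-- keeps this sum positive, so its absolute value strictly decreases.
module Submission where

open import Defs
open import Data.Integer using (_+_; ∣_∣; +<+)
open import Data.Maybe using (just; nothing)
import Data.Nat as ℕ
open import Data.Nat using (ℕ; suc; _<_; s≤s)
open import Data.Nat.Induction using (<-wellFounded)
open import Data.Nat.Properties using (≤-reflexive)
open import Data.Nat.Tactic.RingSolver using (solve-∀)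
open import Data.Product using (_,_)
open import Function using (flip)
open import Induction.WellFounded using (WellFounded; Acc; acc; module Subrelation)
import Relation.Binary.Construct.On as On
open import Relation.Binary.PropositionalEquality using (_≡_; refl)

-- `x + y + z` is a ranking function: while the loop runs it is a positive integer, and each choice
-- of control lowers it by exactly 1. Hence the converse of `Step` is well-founded, and for any
-- program this makes computations finite (`wellFounded⇒finite`).

module _ {P : Program} {c : Sequence (Program.State P)} (comp : IsComputation P c) where
  open Program P
  open Sequence c
  open IsComputation comp

  -- Induction on accessibility, with `i` general so that it can walk along the sequence: either the
  -- next term is undefined, or it is a `Step` successor, accessible by a smaller proof.
  accessible⇒finite : ∀ i {s} → at i ≡ just s → Acc (flip Step) s → IsFinite c
  accessible⇒finite i at-i (acc rec) with at (suc i) in at-1+i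
  ... | nothing = suc i , at-1+i
  ... | just t  = accessible⇒finite (suc i) at-1+i (rec (steps i at-i at-1+i))

  wellFounded⇒finite : WellFounded (flip Step) → IsFinite c
  wellFounded⇒finite wf with starts
  ... | s , at-0 , _ = accessible⇒finite 0 at-0 (wf s)

-- The absolute value serves to land in `ℕ`; it changes nothing before or after an iteration, where
-- all coordinates are nonnegative.
∣sum∣ : ℤ³ → ℕ
∣sum∣ (x , y , z) = ∣ x + y + z ∣

∣sum∣-loopBody : ∀ control {s} → LoopCondition s → ∣sum∣ (loopBody control s) < ∣sum∣ s
-- The match makes the coordinates `suc a`, `suc b`, `suc c`, so the integer operations compute to
-- those on `ℕ` and an identity in `ℕ` remains.
∣sum∣-loopBody control₁ (+<+ (s≤s {n = a} _) , +<+ (s≤s {n = b} _) , +<+ (s≤s {n = c} _)) =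
  ≤-reflexive (eq a b c)
  where
  eq : ∀ a b c → suc (suc a ℕ.+ 1 ℕ.+ b ℕ.+ c) ≡ suc a ℕ.+ suc b ℕ.+ suc c
  eq = solve-∀
∣sum∣-loopBody control₂ (+<+ (s≤s {n = a} _) , +<+ (s≤s {n = b} _) , +<+ (s≤s {n = c} _)) =
  ≤-reflexive (eq a b c)
  where
  eq : ∀ a b c → suc (a ℕ.+ (suc b ℕ.+ 1) ℕ.+ c) ≡ suc a ℕ.+ suc b ℕ.+ suc c
  eq = solve-∀
∣sum∣-loopBody control₃ (+<+ (s≤s {n = a} _) , +<+ (s≤s {n = b} _) , +<+ (s≤s {n = c} _)) =
  ≤-reflexive (eq a b c)
  where
  eq : ∀ a b c → suc (a ℕ.+ b ℕ.+ (suc c ℕ.+ 1)) ≡ suc a ℕ.+ suc b ℕ.+ suc c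
  eq = solve-∀

program-wellFounded : WellFounded (flip (Program.Step program))
program-wellFounded = Subrelation.wellFounded
  (λ { (cond , control , refl) → ∣sum∣-loopBody control cond })
  (On.wellFounded ∣sum∣ <-wellFounded)

theorem3p1 : (c : Sequence ℤ³) → IsComputation program c → IsFinite c
theorem3p1 c comp = wellFounded⇒finite comp program-wellFounded
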